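{- Let $m>1$ be an integer. For each prime power $q$ with $q\,\|\,m$ let $r_q\ge 0$ be an integer and let $\mathbf v_{q,1},\ldots,\mathbf v_{q,r_q}\in(\mathbb{Z}_q)^n$, and set $r=\sum_{q\|m} r_q$. Then the number of solutions $\mathbf x\in B^n$ of the system \[ \mathbf v_{q,i}^T\mathbf x= 0 \text{ in } \mathbb{Z}_q,\qquad 1\le i\le r_q,\ q\,\|\,m, \] is at least $2$ if $n\ge mr\log m$, and is at least $2^{\,n-mr\log m\log n}$.
   Context: $B=\{0,1\}\subseteq\mathbb{Z}$. For a prime power $q=p^a$, $q\,\|\,m$ means $p^a\mid m$ but $p^{a+1}\nmid m$.
   Formalization: Here log is base 2; n ≥ 1 is assumed (for n = 0, r = 0 there is only one solution), and the second bound is claimed only for n ≥ 2, since it fails for n = 1 (m = 2, one equation x = 0 in Z_2: one solution, but the bound is 2). -}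

module Defs where

open import Data.Nat using (ℕ; zero; suc; _+_; _*_; _^_; _≤_)
open import Data.Nat.Divisibility using (_∣_)
open import Data.Nat.Primality using (Prime)
open import Data.Bool using (Bool; true; false)
open import Data.Fin using (Fin; toℕ)
open import Data.Vec using (Vec; []; _∷_)
open import Data.Product using (Σ; _×_)
open import Relation.Binary.PropositionalEquality using (_≡_)
open import Relation.Nullary using (¬_)
open import Function.Definitions using (Injective)

_∥_ : ℕ → ℕ → Set
q ∥ m = Σ ℕ λ p → Σ ℕ λ a →
  Prime p × 1 ≤ a × q ≡ p ^ a × (p ^ a ∣ m) × ¬ (p ^ suc a ∣ m)

-- B = {0,1} ⊆ ℤ ; an element of B^n is a Vec Bool n, false ↦ 0, true ↦ 1.
bit : Bool → ℕ
bit false = 0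
bit true  = 1

-- v^T x computed in ℕ from the representatives 0..q-1 of ℤ_q;
-- "v^T x = 0 in ℤ_q" is then  q ∣ dot v x.
dot : ∀ {n q} → Vec (Fin q) n → Vec Bool n → ℕ
dot [] [] = 0
dot (a ∷ v) (b ∷ x) = toℕ a * bit b + dot v x

Solution : (m : ℕ) {n : ℕ} {r : ℕ → ℕ} → ((q : ℕ) → Fin (r q) → Vec (Fin q) n) →
           Vec Bool n → Set
Solution m v x = ∀ q → q ∥ m → ∀ i → q ∣ dot (v q i) x

AtLeast : ∀ {n} → ℕ → (Vec Bool n → Set) → Set
AtLeast {n} c P = Σ (Fin c → Vec Bool n) λ f → Injective _≡_ _≡_ f × (∀ i → P (f i))

-- PowBound K m n c  encodes the real inequality  c ≥ 2 ^ (n - K · log₂ m · log₂ n)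
-- exactly, via rational upper approximations a = p₁/q₁ ≥ log₂ m (i.e. m^q₁ ≤ 2^p₁)
-- and b = p₂/q₂ ≥ log₂ n (i.e. n^q₂ ≤ 2^p₂):  c^(q₁q₂) · 2^(K p₁ p₂) ≥ 2^(n q₁ q₂),
-- i.e. c ≥ 2^(n - K a b). By continuity (inf ab = log₂ m · log₂ n) this is equivalent.
PowBound : ℕ → ℕ → ℕ → ℕ → Set
PowBound K m n c = ∀ p₁ q₁ p₂ q₂ → 1 ≤ q₁ → 1 ≤ q₂ →
  m ^ q₁ ≤ 2 ^ p₁ → n ^ q₂ ≤ 2 ^ p₂ →
  2 ^ (n * (q₁ * q₂)) ≤ c ^ (q₁ * q₂) * 2 ^ (K * (p₁ * p₂))

{-# OPTIONS --safe #-}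
module Submission where

-- Let G = ∏ ℤ_q^{r_q}, so |G| ≤ m^r, and regard the columns g₁, …, gₙ of the system as elements of G. A character
-- of G takes at most m values at gᵢ, so choosing tᵢ ∈ ℤ_m greedily makes the number of characters ψ with ψ(gᵢ) ≠ ω^{tᵢ}
-- for all i ≤ j shrink by the factor 1 − 1/m at each step; since (1 − 1/m)^m ≤ 1/2, none is left when n ≥ m r log₂ m.
-- Then ∏ (1 − ω^{-tᵢ} gᵢ) is killed by every character, and averaging over the characters shows that the empty
-- zero-sum cannot be the only one. No roots of unity are needed: the powers of ω are replaced by the values of a
-- function κ : ℤ → ℤ, the product over q = p^a of the indicators of 0 minus those of p^(a-1) mod q.
-- Olson's doubling argument then gives at least 2^n / m^(m r) solutions, and log₂ n ≥ 1.

open import Defs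
open import Data.Bool using (Bool; true; false; if_then_else_; _xor_)
import Data.Bool.Properties as Bool
open import Data.Fin as Fin using (Fin; zero; suc; splitAt; join)
import Data.Fin.Properties as Fin
open import Data.Integer as ℤ using (ℤ; +_; -[1+_]; 0ℤ; 1ℤ)
import Data.Integer.Properties as ℤ
open import Data.Integer.DivMod using (_%ℕ_; _/ℕ_; n%ℕd<d; a≡a%ℕn+[a/ℕn]*n)
open import Data.Integer.Divisibility.Signed using (_∣_; _∣?_; divides; ∣ᵤ⇒∣; ∣⇒∣ᵤ; ∣-trans; ∣m∣n⇒∣m+n; ∣m+n∣n⇒∣m; ∣n⇒∣m*n; ∣m⇒∣m*n; ∣m⇒∣-m)
open import Data.Integer.Tactic.RingSolver using (solve-∀)
open import Data.List as List using (List; map; []; _∷_; _++_; length; filter)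
import Data.List.Properties as List
open import Data.List.Membership.Propositional using (_∈_)
open import Data.List.Membership.Propositional.Properties using (∈-++⁺ˡ; ∈-++⁺ʳ; ∈-tabulate⁺; ∈-lookup)
open import Data.List.Relation.Unary.All as All using (All; []; _∷_)
import Data.List.Relation.Unary.All.Properties as All
open import Data.List.Relation.Unary.AllPairs using ([]; _∷_)
open import Data.List.Relation.Unary.Any using (here; there; index)
open import Data.List.Relation.Unary.Any.Properties using (lookup-index)
open import Data.List.Relation.Unary.Unique.Propositional using (Unique)
open import Data.Nat as ℕ using (ℕ; zero; suc; _+_; _*_; _^_; _≤_; _<_; z≤n; s≤s; NonZero)
import Data.Nat.Divisibility as ℕ
import Data.Nat.Properties as ℕ
open import Data.Nat.Coprimality using (Coprime; coprime-Bézout)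
open import Data.Nat.GCD using (module Bézout)
open import Data.Nat.ListAction using (sum)
open import Data.Nat.Primality using (Prime; euclidsLemma; prime⇒irreducible; prime⇒nonZero; prime⇒nonTrivial; ¬prime[1])
open import Data.Nat.Tactic.RingSolver using () renaming (solve-∀ to solveℕ-∀)
open import Data.Product using (Σ; ∃; _×_; _,_; proj₁; proj₂)
open import Data.Sum using (inj₁; inj₂; [_,_]′)
open import Data.Vec as Vec using (Vec; []; _∷_; zipWith; lookup; replicate; insertAt; removeAt)
import Data.Vec.Properties as Vec
open import Data.Vec.Relation.Unary.Any as VAny using (here; there)
open import Function using (_∘_)
open import Function.Definitions using (Injective)
open import Relation.Binary.PropositionalEquality
open import Relation.Nullary using (¬_; Dec; yes; no; does; contradiction; ¬?)
open import Relation.Nullary.Decidable using (_×-dec_; _⊎-dec_; map′; dec-false; decidable-stable)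

-- The kernel κ

Σ< : ℕ → (ℕ → ℤ) → ℤ
Σ< zero    f = 0ℤ
Σ< (suc k) f = Σ< k f ℤ.+ f k

Σ<-cong : ∀ k {f g} → (∀ i → f i ≡ g i) → Σ< k f ≡ Σ< k g
Σ<-cong zero    f≗g = refl
Σ<-cong (suc k) f≗g = cong₂ ℤ._+_ (Σ<-cong k f≗g) (f≗g k)

Σ<-zero : ∀ k {f} → (∀ i → f i ≡ 0ℤ) → Σ< k f ≡ 0ℤ
Σ<-zero zero    f≗0 = refl
Σ<-zero (suc k) f≗0 = cong₂ ℤ._+_ (Σ<-zero k f≗0) (f≗0 k)

Σ<-distrib-+ : ∀ k f g → Σ< k (λ i → f i ℤ.+ g i) ≡ Σ< k f ℤ.+ Σ< k g
Σ<-distrib-+ zero    f g = refl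
Σ<-distrib-+ (suc k) f g = trans (cong (ℤ._+ (f k ℤ.+ g k)) (Σ<-distrib-+ k f g)) (interchange (Σ< k f) (Σ< k g) (f k) (g k))
  where
  interchange : ∀ a b c d → (a ℤ.+ b) ℤ.+ (c ℤ.+ d) ≡ (a ℤ.+ c) ℤ.+ (b ℤ.+ d)
  interchange = solve-∀

Σ<-neg : ∀ k f → Σ< k (λ i → ℤ.- f i) ≡ ℤ.- Σ< k f
Σ<-neg zero    f = refl
Σ<-neg (suc k) f = trans (cong (ℤ._+ (ℤ.- f k)) (Σ<-neg k f)) (sym (ℤ.neg-distrib-+ (Σ< k f) (f k)))

Σ<-*ʳ : ∀ k f c → Σ< k (λ i → f i ℤ.* c) ≡ Σ< k f ℤ.* c
Σ<-*ʳ zero    f c = refl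
Σ<-*ʳ (suc k) f c = trans (cong (ℤ._+ (f k ℤ.* c)) (Σ<-*ʳ k f c)) (sym (ℤ.*-distribʳ-+ c (Σ< k f) (f k)))

Σ<-*ˡ : ∀ k c f → Σ< k (λ i → c ℤ.* f i) ≡ c ℤ.* Σ< k f
Σ<-*ˡ k c f = begin
  Σ< k (λ i → c ℤ.* f i)  ≡⟨ Σ<-cong k (λ i → ℤ.*-comm c (f i)) ⟩
  Σ< k (λ i → f i ℤ.* c)  ≡⟨ Σ<-*ʳ k f c ⟩
  Σ< k f ℤ.* c            ≡⟨ ℤ.*-comm (Σ< k f) c ⟩
  c ℤ.* Σ< k f            ∎
  where open ≡-Reasoning

suc-invariant⇒constant : (S : ℤ → ℤ) → (∀ z → S (1ℤ ℤ.+ z) ≡ S z) → ∀ z → S z ≡ S 0ℤ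
suc-invariant⇒constant S inv (+ zero)       = refl
suc-invariant⇒constant S inv (+ suc n)      = trans (inv (+ n)) (suc-invariant⇒constant S inv (+ n))
suc-invariant⇒constant S inv -[1+ zero ]    = sym (inv -[1+ 0 ])
suc-invariant⇒constant S inv -[1+ suc n ]   =
  trans (sym (inv -[1+ suc n ])) (suc-invariant⇒constant S inv -[1+ n ])

Σ<-head : ∀ k f → Σ< (suc k) f ≡ f 0 ℤ.+ Σ< k (f ∘ suc)
Σ<-head zero    f = ℤ.+-comm 0ℤ (f 0)
Σ<-head (suc k) f = trans (cong (ℤ._+ f (suc k)) (Σ<-head k f)) (ℤ.+-assoc (f 0) _ _)

-- Moving the window by one trades its first term for the one `q` places later, and these agree by
-- periodicity.
Σ<-shift : ∀ q (φ : ℤ → ℤ) → (∀ z → φ (z ℤ.+ + q) ≡ φ z) →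
           ∀ z → Σ< q (λ i → φ (z ℤ.+ + i)) ≡ Σ< q (λ i → φ (+ i))
Σ<-shift q φ per z = trans (suc-invariant⇒constant S inv z) (Σ<-cong q (λ i → cong φ (ℤ.+-identityˡ (+ i))))
  where
  S : ℤ → ℤ
  S z = Σ< q (λ i → φ (z ℤ.+ + i))

  cancel : ∀ a b → b ℤ.+ a ℤ.- a ≡ b
  cancel = solve-∀

  reassoc : ∀ z i → 1ℤ ℤ.+ z ℤ.+ i ≡ z ℤ.+ (1ℤ ℤ.+ i)
  reassoc = solve-∀

  inv : ∀ z → S (1ℤ ℤ.+ z) ≡ S z
  inv z = begin
    S (1ℤ ℤ.+ z)                                      ≡⟨ Σ<-cong q (λ i → cong φ (reassoc z (+ i))) ⟩
    Σ< q (ψ ∘ suc)                                    ≡⟨ cancel (ψ 0) _ ⟨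
    Σ< q (ψ ∘ suc) ℤ.+ ψ 0 ℤ.- ψ 0                    ≡⟨ cong (ℤ._- ψ 0) (ℤ.+-comm _ (ψ 0)) ⟩
    ψ 0 ℤ.+ Σ< q (ψ ∘ suc) ℤ.- ψ 0                    ≡⟨ cong (ℤ._- ψ 0) (Σ<-head q ψ) ⟨
    Σ< q ψ ℤ.+ ψ q ℤ.- ψ 0                            ≡⟨ cong (λ w → Σ< q ψ ℤ.+ w ℤ.- ψ 0) wrap ⟩
    Σ< q ψ ℤ.+ ψ 0 ℤ.- ψ 0                            ≡⟨ cancel (ψ 0) _ ⟩
    S z                                               ∎
    where
    open ≡-Reasoning
    ψ : ℕ → ℤ
    ψ i = φ (z ℤ.+ + i)
    wrap : ψ q ≡ ψ 0
    wrap = trans (per z) (cong φ (sym (ℤ.+-identityʳ z)))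

indicator : ∀ {A : Set} → Dec A → ℤ
indicator A? = if does A? then 1ℤ else 0ℤ

indicator-yes : ∀ {A : Set} (A? : Dec A) → A → indicator A? ≡ 1ℤ
indicator-yes (yes _) a = refl
indicator-yes (no ¬a) a = contradiction a ¬a

indicator-no : ∀ {A : Set} (A? : Dec A) → ¬ A → indicator A? ≡ 0ℤ
indicator-no (yes a) ¬a = contradiction a ¬a
indicator-no (no _)  ¬a = refl

indicator-cong : ∀ {A B : Set} (A? : Dec A) (B? : Dec B) → (A → B) → (B → A) → indicator A? ≡ indicator B?
indicator-cong (yes a) B? to from = sym (indicator-yes B? (to a))
indicator-cong (no ¬a) B? to from = sym (indicator-no B? (¬a ∘ from))

δ : ℕ → ℤ → ℤ
δ q e = indicator (+ q ∣? e)

δ-periodic : ∀ q {d} → + q ∣ d → ∀ e → δ q (e ℤ.+ d) ≡ δ q e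
δ-periodic q {d} q∣d e = indicator-cong (+ q ∣? (e ℤ.+ d)) (+ q ∣? e) (λ h → ∣m+n∣n⇒∣m {m = e} h q∣d) (λ h → ∣m∣n⇒∣m+n h q∣d)

-- On a coset of the subgroup generated by y the two delta functions cancel as soon as that subgroup contains k.
step : ℕ → ℕ → ℤ → ℤ
step q k e = δ q e ℤ.- δ q (e ℤ.- + k)

step-periodic : ∀ q k {d} → + q ∣ d → ∀ e → step q k (e ℤ.+ d) ≡ step q k e
step-periodic q k {d} q∣d e = cong₂ ℤ._-_ (δ-periodic q q∣d e)
  (trans (cong (δ q) (reorder e d (+ k))) (δ-periodic q q∣d (e ℤ.- + k)))
  where
  reorder : ∀ e d k → e ℤ.+ d ℤ.- k ≡ e ℤ.- k ℤ.+ d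
  reorder = solve-∀

-- Since `u y ≡ k` modulo `q`, subtracting `k` amounts to replacing `i` by `i - u`, and a sum over a
-- full period does not notice this shift. So both halves of `step` have the same sum.
step-orthogonal : ∀ q k u y → + q ∣ u ℤ.* y ℤ.- + k →
                  ∀ e → Σ< q (λ i → step q k (e ℤ.+ + i ℤ.* y)) ≡ 0ℤ
step-orthogonal q k u y q∣uy-k e = begin
  Σ< q (λ i → φ (+ i) ℤ.- φ′ i)               ≡⟨ Σ<-distrib-+ q (λ i → φ (+ i)) (λ i → ℤ.- φ′ i) ⟩
  Σ< q (λ i → φ (+ i)) ℤ.+ Σ< q (λ i → ℤ.- φ′ i)
    ≡⟨ cong (ℤ._+_ (Σ< q (λ i → φ (+ i)))) (trans (Σ<-neg q φ′) (cong ℤ.-_ (trans (Σ<-cong q translate) (Σ<-shift q φ periodic (ℤ.- u))))) ⟩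
  Σ< q (λ i → φ (+ i)) ℤ.- Σ< q (λ i → φ (+ i)) ≡⟨ ℤ.+-inverseʳ (Σ< q (λ i → φ (+ i))) ⟩
  0ℤ ∎
  where
  open ≡-Reasoning
  φ : ℤ → ℤ
  φ z = δ q (e ℤ.+ z ℤ.* y)
  φ′ : ℕ → ℤ
  φ′ i = δ q (e ℤ.+ + i ℤ.* y ℤ.- + k)
  expand : ∀ e z q y → e ℤ.+ (z ℤ.+ q) ℤ.* y ≡ e ℤ.+ z ℤ.* y ℤ.+ y ℤ.* q
  expand = solve-∀
  periodic : ∀ z → φ (z ℤ.+ + q) ≡ φ z
  periodic z = trans (cong (δ q) (expand e z (+ q) y)) (δ-periodic q (divides y refl) (e ℤ.+ z ℤ.* y))
  split : ∀ e i y k u → e ℤ.+ i ℤ.* y ℤ.- k ≡ e ℤ.+ (ℤ.- u ℤ.+ i) ℤ.* y ℤ.+ (u ℤ.* y ℤ.- k)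
  split = solve-∀
  translate : ∀ i → φ′ i ≡ φ (ℤ.- u ℤ.+ + i)
  translate i = trans (cong (δ q) (split e (+ i) y (+ k) u)) (δ-periodic q q∣uy-k (e ℤ.+ (ℤ.- u ℤ.+ + i) ℤ.* y))

prime∤⇒coprime : ∀ {p n} → Prime p → ¬ p ℕ.∣ n → Coprime p n
prime∤⇒coprime pp p∤n (d∣p , d∣n) with prime⇒irreducible pp d∣p
... | inj₁ d≡1  = d≡1
... | inj₂ refl = contradiction d∣n p∤n

pos-bézout : ∀ d y n x m → d + y * n ≡ x * m → + d ℤ.+ + y ℤ.* + n ≡ + x ℤ.* + m
pos-bézout d y n x m eq = begin
  + d ℤ.+ + y ℤ.* + n  ≡⟨ cong (λ w → + d ℤ.+ w) (ℤ.pos-* y n) ⟨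
  + (d + y * n)        ≡⟨ cong +_ eq ⟩
  + (x * m)            ≡⟨ ℤ.pos-* x m ⟩
  + x ℤ.* + m          ∎
  where open ≡-Reasoning

inverse-mod-ℕ : ∀ {p} n → Prime p → ¬ p ℕ.∣ n → ∃ λ u → + p ∣ u ℤ.* + n ℤ.- 1ℤ
inverse-mod-ℕ {p} n pp p∤n with coprime-Bézout (prime∤⇒coprime pp p∤n)
-- Here `1 + y n = x p`, so the inverse of `n` is `- y`; in the other case `1 + x p = y n`.
... | Bézout.+- x y eq = ℤ.- + y , divides (ℤ.- + x) (trans (lhs (+ y) (+ n)) (trans (cong ℤ.-_ (pos-bézout 1 y n x p eq)) (ℤ.neg-distribˡ-* (+ x) (+ p))))
  where
  lhs : ∀ y n → ℤ.- y ℤ.* n ℤ.- 1ℤ ≡ ℤ.- (1ℤ ℤ.+ y ℤ.* n)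
  lhs = solve-∀
... | Bézout.-+ x y eq = + y , divides (+ x) (trans (cong (ℤ._- 1ℤ) (sym (pos-bézout 1 x p y n eq))) (lhs (+ x ℤ.* + p)))
  where
  lhs : ∀ w → 1ℤ ℤ.+ w ℤ.- 1ℤ ≡ w
  lhs = solve-∀

inverse-mod : ∀ {p} y → Prime p → ¬ + p ∣ y → ∃ λ u → + p ∣ u ℤ.* y ℤ.- 1ℤ
inverse-mod (+ n) pp p∤y = inverse-mod-ℕ n pp (p∤y ∘ ∣ᵤ⇒∣)
inverse-mod -[1+ n ] pp p∤y with inverse-mod-ℕ (suc n) pp (p∤y ∘ ∣ᵤ⇒∣)
... | u , p∣ = ℤ.- u , subst (λ w → _ ∣ w ℤ.- 1ℤ) (flip u (+ suc n)) p∣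
  where
  flip : ∀ u n → u ℤ.* n ≡ (ℤ.- u) ℤ.* (ℤ.- n)
  flip = solve-∀

-- Every nonzero subgroup of the cyclic group of order p^(a+1) contains p^a. If `p` does not divide
-- `y`, an inverse of `y` modulo `p`, multiplied by p^a, is precise enough; otherwise one factor `p`
-- is removed from `y`, the modulus and the target.
multiple≡p^a : ∀ {p} → Prime p → ∀ a y → ¬ + (p ^ suc a) ∣ y →
               ∃ λ u → + (p ^ suc a) ∣ u ℤ.* y ℤ.- + (p ^ a)
multiple≡p^a {p} pp a y ∤y with + p ∣? y
... | no p∤y with inverse-mod y pp p∤y
...   | u , divides w eq = + (p ^ a) ℤ.* u , divides w (begin
  + (p ^ a) ℤ.* u ℤ.* y ℤ.- + (p ^ a)    ≡⟨ factor (+ (p ^ a)) u y ⟩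
  + (p ^ a) ℤ.* (u ℤ.* y ℤ.- 1ℤ)         ≡⟨ cong (λ t → + (p ^ a) ℤ.* t) eq ⟩
  + (p ^ a) ℤ.* (w ℤ.* + p)              ≡⟨ swap (+ (p ^ a)) w (+ p) ⟩
  w ℤ.* (+ p ℤ.* + (p ^ a))              ≡⟨ cong (w ℤ.*_) (ℤ.pos-* p (p ^ a)) ⟨
  w ℤ.* + (p ^ suc a)                    ∎)
  where
  open ≡-Reasoning
  factor : ∀ k u y → k ℤ.* u ℤ.* y ℤ.- k ≡ k ℤ.* (u ℤ.* y ℤ.- 1ℤ)
  factor = solve-∀
  swap : ∀ k w p → k ℤ.* (w ℤ.* p) ≡ w ℤ.* (p ℤ.* k)
  swap = solve-∀
multiple≡p^a {p} pp zero y ∤y | yes p∣y = contradiction (subst (λ w → + w ∣ y) (sym (ℕ.^-identityʳ p)) p∣y) ∤y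
multiple≡p^a {p} pp (suc a) y ∤y | yes (divides y′ refl)
  with multiple≡p^a pp a y′ (λ { (divides w refl) → ∤y (divides w (trans (rot w (+ (p ^ suc a)) (+ p)) (cong (w ℤ.*_) (sym (ℤ.pos-* p (p ^ suc a)))))) })
  where
  rot : ∀ w k p → w ℤ.* k ℤ.* p ≡ w ℤ.* (p ℤ.* k)
  rot = solve-∀
... | u , divides w eq = u , divides w (begin
  u ℤ.* (y′ ℤ.* + p) ℤ.- + (p ^ suc a)      ≡⟨ cong (λ k → u ℤ.* (y′ ℤ.* + p) ℤ.- k) (ℤ.pos-* p (p ^ a)) ⟩
  u ℤ.* (y′ ℤ.* + p) ℤ.- + p ℤ.* + (p ^ a)  ≡⟨ factor u y′ (+ p) (+ (p ^ a)) ⟩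
  (u ℤ.* y′ ℤ.- + (p ^ a)) ℤ.* + p          ≡⟨ cong (ℤ._* + p) eq ⟩
  w ℤ.* + (p ^ suc a) ℤ.* + p               ≡⟨ rot w (+ (p ^ suc a)) (+ p) ⟩
  w ℤ.* (+ p ℤ.* + (p ^ suc a))             ≡⟨ cong (w ℤ.*_) (ℤ.pos-* p (p ^ suc a)) ⟨
  w ℤ.* + (p ^ suc (suc a))                 ∎)
  where
  open ≡-Reasoning
  factor : ∀ u y p k → u ℤ.* (y ℤ.* p) ℤ.- p ℤ.* k ≡ (u ℤ.* y ℤ.- k) ℤ.* p
  factor = solve-∀
  rot : ∀ w k p → w ℤ.* k ℤ.* p ≡ w ℤ.* (p ℤ.* k)
  rot = solve-∀

PrimePower : ℕ → Set
PrimePower q = Σ ℕ λ p → Σ ℕ λ a → Prime p × q ≡ p ^ suc a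

-- An integer-valued stand-in for the character e ↦ ω ^ e with ω a primitive root of unity:
-- all that the averaging argument needs is that its sum over a nontrivial coset vanishes.
record Kernel (qs : List ℕ) : Set where
  field
    κ          : ℤ → ℤ
    κ-0        : κ 0ℤ ≡ 1ℤ
    periodic   : ∀ {d} → All (λ q → + q ∣ d) qs → ∀ e → κ (e ℤ.+ d) ≡ κ e
    orthogonal : ∀ {q y} → q ∈ qs → (∀ {q′} → q′ ∈ qs → q′ ≢ q → + q′ ∣ y) → ¬ + q ∣ y →
                 ∀ e → Σ< q (λ i → κ (e ℤ.+ + i ℤ.* y)) ≡ 0ℤ

p^[1+a]∤p^a : ∀ {p} → Prime p → ∀ a → ¬ p ^ suc a ℕ.∣ p ^ a
p^[1+a]∤p^a {p} pp a d = ℕ.<⇒≱ (ℕ.^-monoʳ-< p (ℕ.nonTrivial⇒n>1 p) (ℕ.n<1+n a)) (ℕ.∣⇒≤ d)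
  where
  instance
    _ = prime⇒nonTrivial pp
    _ = prime⇒nonZero pp
    _ = ℕ.m^n≢0 p a

step-0 : ∀ {p} → Prime p → ∀ a → step (p ^ suc a) (p ^ a) 0ℤ ≡ 1ℤ
step-0 {p} pp a = cong₂ ℤ._-_ (indicator-yes (+ q ∣? 0ℤ) (divides 0ℤ refl)) (indicator-no (+ q ∣? (0ℤ ℤ.- + k)) q∤-k)
  where
  q = p ^ suc a
  k = p ^ a
  negate : ∀ k → ℤ.- (0ℤ ℤ.- k) ≡ k
  negate = solve-∀
  q∤-k : ¬ + q ∣ 0ℤ ℤ.- + k
  q∤-k d = p^[1+a]∤p^a pp a (∣⇒∣ᵤ (subst (+ q ∣_) (negate (+ k)) (∣m⇒∣-m d)))

-- Along the multiples of `y` every factor except the one for `q` is constant, because the other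
-- prime powers divide `y`. It can be pulled out of the sum, which leaves `step-orthogonal` for `q`.
kernel : ∀ {qs} → Unique qs → All PrimePower qs → Kernel qs
kernel [] [] = record { κ = λ _ → 1ℤ ; κ-0 = refl ; periodic = λ _ _ → refl ; orthogonal = λ () }
kernel {q₀ ∷ qs} (q₀∉qs ∷ uniq) ((p , a , pp , refl) ∷ pps) = record
  { κ          = κ
  ; κ-0        = cong₂ ℤ._*_ (step-0 pp a) K.κ-0
  ; periodic   = λ { (q₀∣d ∷ qs∣d) e → cong₂ ℤ._*_ (step-periodic q₀ k q₀∣d e) (K.periodic qs∣d e) }
  ; orthogonal = orthogonal
  }
  where
  module K = Kernel (kernel uniq pps)
  k = p ^ a
  κ : ℤ → ℤ
  κ e = step q₀ k e ℤ.* K.κ e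

  orthogonal : ∀ {q y} → q ∈ q₀ ∷ qs → (∀ {q′} → q′ ∈ q₀ ∷ qs → q′ ≢ q → + q′ ∣ y) → ¬ + q ∣ y →
               ∀ e → Σ< q (λ i → κ (e ℤ.+ + i ℤ.* y)) ≡ 0ℤ
  orthogonal {y = y} (here refl) others ∤y e with multiple≡p^a pp a y ∤y
  ... | u , q∣uy-k = begin
    Σ< q₀ (λ i → κ (e ℤ.+ + i ℤ.* y))
      ≡⟨ Σ<-cong q₀ (λ i → cong (step q₀ k (e ℤ.+ + i ℤ.* y) ℤ.*_) (K.periodic (rest i) e)) ⟩
    Σ< q₀ (λ i → step q₀ k (e ℤ.+ + i ℤ.* y) ℤ.* K.κ e)
      ≡⟨ Σ<-*ʳ q₀ _ (K.κ e) ⟩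
    Σ< q₀ (λ i → step q₀ k (e ℤ.+ + i ℤ.* y)) ℤ.* K.κ e
      ≡⟨ cong (ℤ._* K.κ e) (step-orthogonal q₀ k u y q∣uy-k e) ⟩
    0ℤ ∎
    where
    open ≡-Reasoning
    rest : ∀ i → All (λ q → + q ∣ + i ℤ.* y) qs
    rest i = All.tabulate λ {q′} q′∈ → ∣n⇒∣m*n (+ i) (others (there q′∈) (≢-sym (All.lookup q₀∉qs q′∈)))
  orthogonal {q} {y} (there q∈qs) others ∤y e = begin
    Σ< q (λ i → κ (e ℤ.+ + i ℤ.* y))
      ≡⟨ Σ<-cong q (λ i → cong (ℤ._* K.κ (e ℤ.+ + i ℤ.* y)) (step-periodic q₀ k (∣n⇒∣m*n (+ i) q₀∣y) e)) ⟩
    Σ< q (λ i → step q₀ k e ℤ.* K.κ (e ℤ.+ + i ℤ.* y))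
      ≡⟨ Σ<-*ˡ q (step q₀ k e) _ ⟩
    step q₀ k e ℤ.* Σ< q (λ i → K.κ (e ℤ.+ + i ℤ.* y))
      ≡⟨ cong (step q₀ k e ℤ.*_) (K.orthogonal q∈qs (others ∘ there) ∤y e) ⟩
    step q₀ k e ℤ.* 0ℤ
      ≡⟨ ℤ.*-zeroʳ (step q₀ k e) ⟩
    0ℤ ∎
    where
    open ≡-Reasoning
    q₀∣y : + q₀ ∣ y
    q₀∣y = others (here refl) (All.lookup q₀∉qs q∈qs)

-- Exact prime-power divisors and their cofactors

p^a∣-cancelˡ : ∀ {p} → Prime p → ∀ a {k} z → ¬ p ℕ.∣ k → p ^ a ℕ.∣ k * z → p ^ a ℕ.∣ z
p^a∣-cancelˡ pp zero z p∤k _ = ℕ.1∣ z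
p^a∣-cancelˡ {p} pp (suc a) {k} z p∤k d with euclidsLemma k z pp (ℕ.∣-trans (ℕ.m∣m*n (p ^ a)) d)
... | inj₁ p∣k = contradiction p∣k p∤k
... | inj₂ (ℕ.divides-refl z′) = subst (p ^ suc a ℕ.∣_) (ℕ.*-comm p z′)
  (ℕ.*-monoʳ-∣ p (p^a∣-cancelˡ pp a z′ p∤k (ℕ.*-cancelˡ-∣ p (subst (p ^ suc a ℕ.∣_) rearrange d))))
  where
  instance _ = prime⇒nonZero pp
  rearrange : k * (z′ * p) ≡ p * (k * z′)
  rearrange = trans (sym (ℕ.*-assoc k z′ p)) (ℕ.*-comm (k * z′) p)

prime∣^⇒∣ : ∀ {p} → Prime p → ∀ n a → p ℕ.∣ n ^ a → p ℕ.∣ n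
prime∣^⇒∣ {p} pp n zero d = contradiction (subst Prime (ℕ.∣1⇒≡1 d) pp) ¬prime[1]
prime∣^⇒∣ pp n (suc a) d with euclidsLemma n (n ^ a) pp d
... | inj₁ p∣n = p∣n
... | inj₂ p∣n^a = prime∣^⇒∣ pp n a p∣n^a

∥⇒primePower : ∀ {q m} → q ∥ m → PrimePower q
∥⇒primePower (p , suc a , pp , _ , q≡ , _) = p , a , pp , q≡

∥⇒∣ : ∀ {q m} → q ∥ m → q ℕ.∣ m
∥⇒∣ (_ , _ , _ , _ , refl , q∣m , _) = q∣m

^-monoʳ-∣ : ∀ p {a b} → a ≤ b → p ^ a ℕ.∣ p ^ b
^-monoʳ-∣ p {a} {b} a≤b = subst (λ c → p ^ a ℕ.∣ p ^ c) (ℕ.m+[n∸m]≡n a≤b)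
  (subst (p ^ a ℕ.∣_) (sym (ℕ.^-distribˡ-+-* p a (b ℕ.∸ a))) (ℕ.m∣m*n _))

∥-maximal : ∀ p {a b m} → p ^ b ℕ.∣ m → ¬ p ^ suc a ℕ.∣ m → b ≤ a
∥-maximal p d nd = ℕ.≮⇒≥ λ a<b → nd (ℕ.∣-trans (^-monoʳ-∣ p a<b) d)

-- Two exact powers of the same prime have equal exponents by maximality, so distinct `q` and `q′`
-- belong to distinct primes. Hence `q′` is coprime to `q` and must divide the cofactor.
∥-cofactor-∣ : ∀ {q q′ m k} → q ∥ m → q′ ∥ m → m ≡ k * q → q′ ≢ q → q′ ℕ.∣ k
∥-cofactor-∣ {k = k} (p , a , pp , _ , refl , d , nd) (p′ , a′ , pp′ , _ , refl , d′ , nd′) m≡ q′≢q =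
  p^a∣-cancelˡ pp′ a′ k p′∤q (subst (p′ ^ a′ ℕ.∣_) (trans m≡ (ℕ.*-comm k (p ^ a))) d′)
  where
  p′∤q : ¬ p′ ℕ.∣ p ^ a
  p′∤q p′∣q with prime⇒irreducible pp (prime∣^⇒∣ pp′ p a p′∣q)
  ... | inj₁ refl = ¬prime[1] pp′
  ... | inj₂ refl = q′≢q (cong (p ^_) (ℕ.≤-antisym (∥-maximal p {a} {a′} d′ nd) (∥-maximal p {a′} {a} d nd′)))

-- The prime `p` does not divide the cofactor `k`, as p^(a+1) would then divide `m`; so `k` cancels.
∥-cofactor-cancel : ∀ {q m k} → q ∥ m → m ≡ k * q → ∀ z → + q ∣ + k ℤ.* z → + q ∣ z
∥-cofactor-cancel {k = k} (p , a , pp , _ , refl , d , nd) m≡ z q∣kz =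
  ∣ᵤ⇒∣ (p^a∣-cancelˡ pp a ℤ.∣ z ∣ p∤k (subst (p ^ a ℕ.∣_) (ℤ.abs-* (+ k) z) (∣⇒∣ᵤ q∣kz)))
  where
  p∤k : ¬ p ℕ.∣ k
  p∤k p∣k = nd (subst (p ^ suc a ℕ.∣_) (sym m≡) (ℕ.*-monoˡ-∣ (p ^ a) p∣k))

-- Alternating sums over characters

ΣL : ∀ {A : Set} → (A → ℤ) → List A → ℤ
ΣL φ []       = 0ℤ
ΣL φ (a ∷ as) = φ a ℤ.+ ΣL φ as

ΣL-cong : ∀ {A : Set} {φ ψ : A → ℤ} → (∀ a → φ a ≡ ψ a) → ∀ as → ΣL φ as ≡ ΣL ψ as
ΣL-cong φ≗ψ []       = refl
ΣL-cong φ≗ψ (a ∷ as) = cong₂ ℤ._+_ (φ≗ψ a) (ΣL-cong φ≗ψ as)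

ΣL-zero : ∀ {A : Set} {φ : A → ℤ} {as} → All (λ a → φ a ≡ 0ℤ) as → ΣL φ as ≡ 0ℤ
ΣL-zero []         = refl
ΣL-zero (eq ∷ eqs) = cong₂ ℤ._+_ eq (ΣL-zero eqs)

ΣL-one : ∀ {A : Set} {φ : A → ℤ} → (∀ a → φ a ≡ 1ℤ) → ∀ as → ΣL φ as ≡ + length as
ΣL-one φ≗1 []       = refl
ΣL-one φ≗1 (a ∷ as) = cong₂ ℤ._+_ (φ≗1 a) (ΣL-one φ≗1 as)

ΣL-++ : ∀ {A : Set} (φ : A → ℤ) as bs → ΣL φ (as ++ bs) ≡ ΣL φ as ℤ.+ ΣL φ bs
ΣL-++ φ []       bs = sym (ℤ.+-identityˡ (ΣL φ bs))
ΣL-++ φ (a ∷ as) bs = trans (cong (λ w → φ a ℤ.+ w) (ΣL-++ φ as bs)) (sym (ℤ.+-assoc (φ a) (ΣL φ as) (ΣL φ bs)))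

ΣL-map : ∀ {A B : Set} (φ : B → ℤ) (f : A → B) as → ΣL φ (List.map f as) ≡ ΣL (φ ∘ f) as
ΣL-map φ f []       = refl
ΣL-map φ f (a ∷ as) = cong (λ w → φ (f a) ℤ.+ w) (ΣL-map φ f as)

Σ<-ΣL-swap : ∀ {A : Set} k (φ : ℕ → A → ℤ) as →
             Σ< k (λ i → ΣL (φ i) as) ≡ ΣL (λ a → Σ< k (λ i → φ i a)) as
Σ<-ΣL-swap k φ []       = Σ<-zero k (λ _ → refl)
Σ<-ΣL-swap k φ (a ∷ as) = trans (Σ<-distrib-+ k (λ i → φ i a) (λ i → ΣL (φ i) as))
  (cong (λ w → Σ< k (λ i → φ i a) ℤ.+ w) (Σ<-ΣL-swap k φ as))

alternating : ∀ n → (Vec Bool n → ℤ) → ℤ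
alternating zero    Φ = Φ []
alternating (suc n) Φ = alternating n (Φ ∘ (false ∷_)) ℤ.- alternating n (Φ ∘ (true ∷_))

alternating-cong : ∀ n {Φ Ψ} → (∀ x → Φ x ≡ Ψ x) → alternating n Φ ≡ alternating n Ψ
alternating-cong zero    Φ≗Ψ = Φ≗Ψ []
alternating-cong (suc n) Φ≗Ψ = cong₂ ℤ._-_ (alternating-cong n (Φ≗Ψ ∘ (false ∷_))) (alternating-cong n (Φ≗Ψ ∘ (true ∷_)))

alternating-zero : ∀ n {Φ} → (∀ x → Φ x ≡ 0ℤ) → alternating n Φ ≡ 0ℤ
alternating-zero zero    Φ≗0 = Φ≗0 []
alternating-zero (suc n) Φ≗0 = cong₂ ℤ._-_ (alternating-zero n (Φ≗0 ∘ (false ∷_))) (alternating-zero n (Φ≗0 ∘ (true ∷_)))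

alternating-+ : ∀ n Φ Ψ → alternating n (λ x → Φ x ℤ.+ Ψ x) ≡ alternating n Φ ℤ.+ alternating n Ψ
alternating-+ zero    Φ Ψ = refl
alternating-+ (suc n) Φ Ψ = trans
  (cong₂ ℤ._-_ (alternating-+ n (Φ ∘ (false ∷_)) (Ψ ∘ (false ∷_))) (alternating-+ n (Φ ∘ (true ∷_)) (Ψ ∘ (true ∷_))))
  (interchange (alternating n (Φ ∘ (false ∷_))) (alternating n (Ψ ∘ (false ∷_))) (alternating n (Φ ∘ (true ∷_))) (alternating n (Ψ ∘ (true ∷_))))
  where
  interchange : ∀ a b c d → (a ℤ.+ b) ℤ.- (c ℤ.+ d) ≡ (a ℤ.- c) ℤ.+ (b ℤ.- d)
  interchange = solve-∀

alternating-ΣL : ∀ {A : Set} n (φ : A → Vec Bool n → ℤ) as →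
                 alternating n (λ x → ΣL (λ a → φ a x) as) ≡ ΣL (λ a → alternating n (φ a)) as
alternating-ΣL n φ []       = alternating-zero n (λ _ → refl)
alternating-ΣL n φ (a ∷ as) = trans (alternating-+ n (φ a) (λ x → ΣL (λ a → φ a x) as))
  (cong (λ w → alternating n (φ a) ℤ.+ w) (alternating-ΣL n φ as))

alternating-single : ∀ n {Φ} → (∀ x k → lookup x k ≡ true → Φ x ≡ 0ℤ) →
                     alternating n Φ ≡ Φ (replicate n false)
alternating-single zero        Φ≗0 = refl
alternating-single (suc n) {Φ} Φ≗0 = trans
  (cong₂ ℤ._-_ (alternating-single n (λ x k → Φ≗0 (false ∷ x) (suc k))) (alternating-zero n (λ x → Φ≗0 (true ∷ x) zero refl)))
  (ℤ.+-identityʳ (Φ (false ∷ replicate n false)))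

-- Integer entries leave room for scaling by cofactors, subtracting targets and negating columns,
-- which would leave the representatives 0, ..., q - 1.
dotℤ : ∀ {n} → Vec ℤ n → Vec Bool n → ℤ
dotℤ []      []          = 0ℤ
dotℤ (a ∷ v) (false ∷ x) = dotℤ v x
dotℤ (a ∷ v) (true  ∷ x) = a ℤ.+ dotℤ v x

infixl 6 _+ᵛ_ _-ᵛ_
infixr 7 _*ᵛ_

_+ᵛ_ _-ᵛ_ : ∀ {n} → Vec ℤ n → Vec ℤ n → Vec ℤ n
_+ᵛ_ = zipWith ℤ._+_
_-ᵛ_ = zipWith ℤ._-_

_*ᵛ_ : ∀ {n} → ℤ → Vec ℤ n → Vec ℤ n
k *ᵛ v = Vec.map (k ℤ.*_) v

dotℤ-+ᵛ : ∀ {n} (u v : Vec ℤ n) x → dotℤ (u +ᵛ v) x ≡ dotℤ u x ℤ.+ dotℤ v x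
dotℤ-+ᵛ []      []      []          = refl
dotℤ-+ᵛ (a ∷ u) (b ∷ v) (false ∷ x) = dotℤ-+ᵛ u v x
dotℤ-+ᵛ (a ∷ u) (b ∷ v) (true ∷ x)  =
  trans (cong (λ w → a ℤ.+ b ℤ.+ w) (dotℤ-+ᵛ u v x)) (interchange a b (dotℤ u x) (dotℤ v x))
  where
  interchange : ∀ a b c d → (a ℤ.+ b) ℤ.+ (c ℤ.+ d) ≡ (a ℤ.+ c) ℤ.+ (b ℤ.+ d)
  interchange = solve-∀

dotℤ--ᵛ : ∀ {n} (u v : Vec ℤ n) x → dotℤ (u -ᵛ v) x ≡ dotℤ u x ℤ.- dotℤ v x
dotℤ--ᵛ []      []      []          = refl
dotℤ--ᵛ (a ∷ u) (b ∷ v) (false ∷ x) = dotℤ--ᵛ u v x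
dotℤ--ᵛ (a ∷ u) (b ∷ v) (true ∷ x)  =
  trans (cong (λ w → a ℤ.- b ℤ.+ w) (dotℤ--ᵛ u v x)) (interchange a b (dotℤ u x) (dotℤ v x))
  where
  interchange : ∀ a b c d → (a ℤ.- b) ℤ.+ (c ℤ.- d) ≡ (a ℤ.+ c) ℤ.- (b ℤ.+ d)
  interchange = solve-∀

dotℤ-*ᵛ : ∀ {n} k (v : Vec ℤ n) x → dotℤ (k *ᵛ v) x ≡ k ℤ.* dotℤ v x
dotℤ-*ᵛ k []      []          = sym (ℤ.*-zeroʳ k)
dotℤ-*ᵛ k (a ∷ v) (false ∷ x) = dotℤ-*ᵛ k v x
dotℤ-*ᵛ k (a ∷ v) (true ∷ x)  =
  trans (cong (λ w → k ℤ.* a ℤ.+ w) (dotℤ-*ᵛ k v x)) (sym (ℤ.*-distribˡ-+ k a (dotℤ v x)))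

dotℤ-zeroʳ : ∀ {n} (v : Vec ℤ n) → dotℤ v (replicate n false) ≡ 0ℤ
dotℤ-zeroʳ []      = refl
dotℤ-zeroʳ (a ∷ v) = dotℤ-zeroʳ v

-- Toggling a coordinate i with m ∣ wᵢ changes the sign of a term but not the value of κ.
alternating-cancel : ∀ {n} m (κ : ℤ → ℤ) → (∀ {d} → + m ∣ d → ∀ e → κ (e ℤ.+ d) ≡ κ e) →
                     (w : Vec ℤ n) → VAny.Any (+ m ∣_) w → ∀ e → alternating n (λ x → κ (e ℤ.+ dotℤ w x)) ≡ 0ℤ
alternating-cancel {suc n} m κ periodic (a ∷ w) (here m∣a) e = trans
  (cong (λ z → S ℤ.- z) (alternating-cong n (λ x → trans (cong κ (reorder e a (dotℤ w x))) (periodic m∣a (e ℤ.+ dotℤ w x)))))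
  (ℤ.+-inverseʳ S)
  where
  S = alternating n (λ x → κ (e ℤ.+ dotℤ w x))
  reorder : ∀ e a d → e ℤ.+ (a ℤ.+ d) ≡ e ℤ.+ d ℤ.+ a
  reorder = solve-∀
alternating-cancel {suc n} m κ periodic (a ∷ w) (there i) e = cong₂ ℤ._-_
  (alternating-cancel m κ periodic w i e)
  (trans (alternating-cong n (λ x → cong κ (sym (ℤ.+-assoc e a (dotℤ w x))))) (alternating-cancel m κ periodic w i (e ℤ.+ a)))

multiples : ∀ {n} → ℕ → Vec ℤ n → List (Vec ℤ n) → List (Vec ℤ n)
multiples zero    h L = []
multiples (suc k) h L = multiples k h L ++ List.map (+ k *ᵛ h +ᵛ_) L

length-multiples : ∀ {n} k (h : Vec ℤ n) L → length (multiples k h L) ≡ k * length L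
length-multiples zero    h L = refl
length-multiples (suc k) h L = begin
  length (multiples k h L ++ List.map (+ k *ᵛ h +ᵛ_) L)          ≡⟨ List.length-++ (multiples k h L) ⟩
  length (multiples k h L) + length (List.map (+ k *ᵛ h +ᵛ_) L)  ≡⟨ cong₂ _+_ (length-multiples k h L) (List.length-map _ L) ⟩
  k * length L + length L                                        ≡⟨ ℕ.+-comm (k * length L) (length L) ⟩
  suc k * length L                                               ∎
  where open ≡-Reasoning

ΣL-multiples : ∀ {n} (φ : Vec ℤ n → ℤ) k h L →
               ΣL φ (multiples k h L) ≡ Σ< k (λ i → ΣL (λ c → φ (+ i *ᵛ h +ᵛ c)) L)
ΣL-multiples φ zero    h L = refl
ΣL-multiples φ (suc k) h L = trans (ΣL-++ φ (multiples k h L) _)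
  (cong₂ ℤ._+_ (ΣL-multiples φ k h L) (ΣL-map φ (+ k *ᵛ h +ᵛ_) L))

-- The value vectors (⟨s , h₁⟩, …, ⟨s , hₙ⟩) of all characters s = (s₁, …, s_R), 0 ≤ s_j < Q j.
characters : ∀ {n} R → (Fin R → ℕ) → (Fin R → Vec ℤ n) → List (Vec ℤ n)
characters {n} zero    Q h = replicate n 0ℤ ∷ []
characters     (suc R) Q h = multiples (Q zero) (h zero) (characters R (Q ∘ suc) (h ∘ suc))

length-characters-≤ : ∀ {n} m R Q (h : Fin R → Vec ℤ n) → (∀ j → Q j ≤ m) → length (characters R Q h) ≤ m ^ R
length-characters-≤ m zero    Q h Q≤m = ℕ.≤-refl
length-characters-≤ m (suc R) Q h Q≤m = ℕ.≤-trans (ℕ.≤-reflexive (length-multiples (Q zero) (h zero) _))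
  (ℕ.*-mono-≤ (Q≤m zero) (length-characters-≤ m R (Q ∘ suc) (h ∘ suc) (Q≤m ∘ suc)))

length-characters-≥ : ∀ {n} R Q (h : Fin R → Vec ℤ n) → (∀ j → 1 ≤ Q j) → 1 ≤ length (characters R Q h)
length-characters-≥ zero    Q h 1≤Q = ℕ.≤-refl
length-characters-≥ (suc R) Q h 1≤Q = ℕ.≤-trans
  (ℕ.*-mono-≤ (1≤Q zero) (length-characters-≥ R (Q ∘ suc) (h ∘ suc) (1≤Q ∘ suc)))
  (ℕ.≤-reflexive (sym (length-multiples (Q zero) (h zero) _)))

-- The sum over characters is an iterated sum with one index per constraint. The sum over index `j`
-- vanishes for every offset, so the contributions of the other indices can be absorbed into `e`.
characters-orthogonal : ∀ {n} (κ : ℤ → ℤ) (x : Vec Bool n) R Q h (j : Fin R) →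
  (∀ e → Σ< (Q j) (λ i → κ (e ℤ.+ + i ℤ.* dotℤ (h j) x)) ≡ 0ℤ) →
  ∀ e → ΣL (λ c → κ (e ℤ.+ dotℤ c x)) (characters R Q h) ≡ 0ℤ
characters-orthogonal κ x (suc R) Q h j vanish e = begin
  ΣL (λ c → κ (e ℤ.+ dotℤ c x)) (characters (suc R) Q h)
    ≡⟨ ΣL-multiples (λ c → κ (e ℤ.+ dotℤ c x)) (Q zero) (h zero) L ⟩
  Σ< (Q zero) (λ i → ΣL (λ c → κ (e ℤ.+ dotℤ (+ i *ᵛ h zero +ᵛ c) x)) L)
    ≡⟨ Σ<-cong (Q zero) (λ i → ΣL-cong (λ c → cong (λ d → κ (e ℤ.+ d)) (expand i c)) L) ⟩
  Σ< (Q zero) (λ i → ΣL (λ c → κ (e ℤ.+ (+ i ℤ.* y ℤ.+ dotℤ c x))) L)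
    ≡⟨ finish j vanish ⟩
  0ℤ ∎
  where
  open ≡-Reasoning
  L = characters R (Q ∘ suc) (h ∘ suc)
  y = dotℤ (h zero) x

  expand : ∀ i c → dotℤ (+ i *ᵛ h zero +ᵛ c) x ≡ + i ℤ.* y ℤ.+ dotℤ c x
  expand i c = trans (dotℤ-+ᵛ (+ i *ᵛ h zero) c x) (cong (ℤ._+ dotℤ c x) (dotℤ-*ᵛ (+ i) (h zero) x))

  reorder : ∀ e a d → e ℤ.+ (a ℤ.+ d) ≡ e ℤ.+ d ℤ.+ a
  reorder = solve-∀

  finish : ∀ j → (∀ e → Σ< (Q j) (λ i → κ (e ℤ.+ + i ℤ.* dotℤ (h j) x)) ≡ 0ℤ) →
           Σ< (Q zero) (λ i → ΣL (λ c → κ (e ℤ.+ (+ i ℤ.* y ℤ.+ dotℤ c x))) L) ≡ 0ℤ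
  -- Exchanging the two sums makes the vanishing one innermost.
  finish zero vanish = trans (Σ<-ΣL-swap (Q zero) _ L) (ΣL-zero (All.universal (λ c →
    trans (Σ<-cong (Q zero) (λ i → cong κ (reorder e (+ i ℤ.* y) (dotℤ c x)))) (vanish (e ℤ.+ dotℤ c x))) L))
  finish (suc j) vanish = Σ<-zero (Q zero) (λ i → trans
    (ΣL-cong (λ c → cong κ (sym (ℤ.+-assoc e (+ i ℤ.* y) (dotℤ c x)))) L)
    (characters-orthogonal κ x R (Q ∘ suc) (h ∘ suc) j vanish (e ℤ.+ + i ℤ.* y)))

-- Averaging and the greedy covering

sum< : ℕ → (ℕ → ℕ) → ℕ
sum< zero    f = 0
sum< (suc k) f = f k + sum< k f

minimum-≤-average : ∀ k f → ∃ λ t → suc k * f t ≤ sum< (suc k) f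
minimum-≤-average zero    f = 0 , ℕ.≤-refl
minimum-≤-average (suc k) f with minimum-≤-average k f
... | t , IH with f t ℕ.≤? f (suc k)
...   | yes ft≤ = t , ℕ.+-mono-≤ ft≤ IH
...   | no  ft≰ = suc k , ℕ.+-monoʳ-≤ (f (suc k)) (ℕ.≤-trans (ℕ.*-monoʳ-≤ (suc k) (ℕ.<⇒≤ (ℕ.≰⇒> ft≰))) IH)

sum<-≤ : ∀ k f → (∀ t → f t ≤ 1) → sum< k f ≤ k
sum<-≤ zero    f f≤1 = z≤n
sum<-≤ (suc k) f f≤1 = ℕ.+-mono-≤ (f≤1 k) (sum<-≤ k f f≤1)

sum<-< : ∀ k f → (∀ t → f t ≤ 1) → ∀ t → t < k → f t ≡ 0 → sum< k f < k
sum<-< (suc k) f f≤1 t t<1+k ft≡0 with t ℕ.≟ k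
... | yes refl rewrite ft≡0 = s≤s (sum<-≤ k f f≤1)
... | no t≢k = ℕ.≤-trans (ℕ.≤-reflexive (sym (ℕ.+-suc (f k) (sum< k f))))
  (ℕ.+-mono-≤ (f≤1 k) (sum<-< k f f≤1 t (ℕ.≤∧≢⇒< (ℕ.≤-pred t<1+k) t≢k) ft≡0))

sum<-+ : ∀ k f g → sum< k (λ t → f t + g t) ≡ sum< k f + sum< k g
sum<-+ zero    f g = refl
sum<-+ (suc k) f g = trans (cong (λ w → f k + g k + w) (sum<-+ k f g)) (interchange (f k) (g k) (sum< k f) (sum< k g))
  where
  interchange : ∀ a b c d → (a + b) + (c + d) ≡ (a + c) + (b + d)
  interchange = solveℕ-∀

sum<-cong : ∀ k {f g} → (∀ t → f t ≡ g t) → sum< k f ≡ sum< k g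
sum<-cong zero    f≗g = refl
sum<-cong (suc k) f≗g = cong₂ _+_ (f≗g k) (sum<-cong k f≗g)

module _ {A : Set} {P : ℕ → A → Set} (P? : ∀ t a → Dec (P t a)) where

  survives : ℕ → A → ℕ
  survives t a = if does (P? t a) then 1 else 0

  length-filter-∷ : ∀ t a as → length (filter (P? t) (a ∷ as)) ≡ survives t a + length (filter (P? t) as)
  length-filter-∷ t a as with does (P? t a)
  ... | true  = refl
  ... | false = refl

  survives-≤1 : ∀ a t → survives t a ≤ 1
  survives-≤1 a t with does (P? t a)
  ... | true  = ℕ.≤-refl
  ... | false = z≤n

  -- Double counting: each element is rejected by at least one of the `suc k` filters, so it is
  -- counted at most `k` times.
  sum-length-filter : ∀ k → (∀ a → ∃ λ t → t < suc k × ¬ P t a) →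
                      ∀ as → sum< (suc k) (λ t → length (filter (P? t) as)) ≤ k * length as
  sum-length-filter k missed [] = ℕ.≤-reflexive (trans (sum<-zero (suc k)) (sym (ℕ.*-zeroʳ k)))
    where
    sum<-zero : ∀ k → sum< k (λ _ → 0) ≡ 0
    sum<-zero zero    = refl
    sum<-zero (suc k) = sum<-zero k
  sum-length-filter k missed (a ∷ as) with missed a
  ... | t , t<1+k , ¬Pta = begin
    sum< (suc k) (λ t → length (filter (P? t) (a ∷ as)))
      ≡⟨ sum<-cong (suc k) (λ t → length-filter-∷ t a as) ⟩
    sum< (suc k) (λ t → survives t a + length (filter (P? t) as))
      ≡⟨ sum<-+ (suc k) (λ t → survives t a) (λ t → length (filter (P? t) as)) ⟩
    sum< (suc k) (λ t → survives t a) + sum< (suc k) (λ t → length (filter (P? t) as))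
      ≤⟨ ℕ.+-mono-≤ (ℕ.≤-pred (sum<-< (suc k) (λ t → survives t a) (survives-≤1 a) t t<1+k (cong (if_then 1 else 0) (dec-false (P? t a) ¬Pta)))) (sum-length-filter k missed as) ⟩
    k + k * length as
      ≡⟨ ℕ.*-suc k (length as) ⟨
    k * suc (length as) ∎
    where open ℕ.≤-Reasoning

  pigeonhole-filter : ∀ k → (∀ a → ∃ λ t → t < suc k × ¬ P t a) →
                      ∀ as → ∃ λ t → suc k * length (filter (P? t) as) ≤ k * length as
  pigeonhole-filter k missed as with minimum-≤-average k (λ t → length (filter (P? t) as))
  ... | t , bound = t , ℕ.≤-trans bound (sum-length-filter k missed as)

-- These are the two leading terms of the binomial expansion of (k+1)^(j+1).
bernoulli : ∀ k j → k ^ suc j + suc j * k ^ j ≤ suc k ^ suc j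
bernoulli k zero    = ℕ.≤-reflexive (lemma k)
  where
  lemma : ∀ k → k * 1 + 1 ≡ suc k * 1
  lemma = solveℕ-∀
bernoulli k (suc j) = begin
  k * (k * k ^ j) + suc (suc j) * (k * k ^ j)                       ≤⟨ ℕ.m≤m+n _ (suc j * k ^ j) ⟩
  k * (k * k ^ j) + suc (suc j) * (k * k ^ j) + suc j * k ^ j       ≡⟨ lemma k j (k ^ j) ⟩
  suc k * (k * k ^ j + suc j * k ^ j)                               ≤⟨ ℕ.*-monoʳ-≤ (suc k) (bernoulli k j) ⟩
  suc k * suc k ^ suc j                                             ∎
  where
  open ℕ.≤-Reasoning
  lemma : ∀ k j z → k * (k * z) + suc (suc j) * (k * z) + suc j * z ≡ suc k * (k * z + suc j * z)
  lemma = solveℕ-∀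

-- At `j = k` the second term of `bernoulli` is (k+1) k^k, which is at least k^(k+1).
2*k^m≤m^m : ∀ k → 2 * k ^ suc k ≤ suc k ^ suc k
2*k^m≤m^m k = ℕ.≤-trans (ℕ.≤-trans (ℕ.≤-reflexive (cong (λ w → k ^ suc k + w) (ℕ.+-identityʳ (k ^ suc k))))
  (ℕ.+-monoʳ-≤ (k ^ suc k) (ℕ.m≤n+m (k * k ^ k) (k ^ k)))) (bernoulli k k)

^-distribʳ-* : ∀ n a b → (a * b) ^ n ≡ a ^ n * b ^ n
^-distribʳ-* zero    a b = refl
^-distribʳ-* (suc n) a b = trans (cong (λ w → a * b * w) (^-distribʳ-* n a b)) (interchange a b (a ^ n) (b ^ n))
  where
  interchange : ∀ a b c d → (a * b) * (c * d) ≡ (a * c) * (b * d)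
  interchange = solveℕ-∀

-- (1 − 1/m)^m ≤ 1/2
shrink : ∀ k {M M′} n → suc k * M′ ≤ k * M → M ^ suc k ≤ 2 ^ suc n → M′ ^ suc k ≤ 2 ^ n
shrink k {M} {M′} n mM′≤kM M^m≤ = ℕ.*-cancelˡ-≤ (2 * suc k ^ m) {{ℕ.m*n≢0 2 (suc k ^ m) {{_}} {{ℕ.m^n≢0 (suc k) m}}}} (begin
  2 * suc k ^ m * M′ ^ m       ≡⟨ ℕ.*-assoc 2 (suc k ^ m) (M′ ^ m) ⟩
  2 * (suc k ^ m * M′ ^ m)     ≡⟨ cong (2 *_) (^-distribʳ-* m (suc k) M′) ⟨
  2 * (suc k * M′) ^ m         ≤⟨ ℕ.*-monoʳ-≤ 2 (ℕ.^-monoˡ-≤ m mM′≤kM) ⟩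
  2 * (k * M) ^ m              ≡⟨ cong (2 *_) (^-distribʳ-* m k M) ⟩
  2 * (k ^ m * M ^ m)          ≡⟨ ℕ.*-assoc 2 (k ^ m) (M ^ m) ⟨
  2 * k ^ m * M ^ m            ≤⟨ ℕ.*-mono-≤ (2*k^m≤m^m k) M^m≤ ⟩
  suc k ^ m * (2 * 2 ^ n)      ≡⟨ swap (suc k ^ m) (2 ^ n) ⟩
  2 * suc k ^ m * 2 ^ n        ∎)
  where
  open ℕ.≤-Reasoning
  m = suc k
  swap : ∀ a b → a * (2 * b) ≡ 2 * a * b
  swap = solveℕ-∀

-- With `c` holding the exponents of a character ψ, this says ψ(gᵢ) = ω^{tᵢ} for some i.
Covers : ∀ {n} → ℕ → Vec ℤ n → Vec ℤ n → Set
Covers m t c = VAny.Any (+ m ∣_) (c -ᵛ t)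

All-unfilter : ∀ {A B : Set} {P R : A → Set} {S : B → Set} (P? : ∀ a → Dec (P a)) (f : A → B) →
               (∀ a → ¬ P a → R a) → (∀ a → S (f a) → R a) →
               ∀ as → All S (List.map f (filter P? as)) → All R as
All-unfilter P? f dropped kept []       ss = []
All-unfilter P? f dropped kept (a ∷ as) ss with P? a
All-unfilter P? f dropped kept (a ∷ as) ss       | no ¬Pa = dropped a ¬Pa ∷ All-unfilter P? f dropped kept as ss
All-unfilter P? f dropped kept (a ∷ as) (s ∷ ss) | yes _  = kept a s ∷ All-unfilter P? f dropped kept as ss

-- Greedy choice: some residue for the first coordinate covers at least 1/m of the remaining vectors.
cover : ∀ k n → 1 ≤ k → (L : List (Vec ℤ (suc n))) → length L ^ suc k ≤ 2 ^ suc n →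
        ∃ λ t → All (Covers (suc k) t) L
-- With one coordinate left, the bound 2 on the power and `suc k ≥ 2` allow at most one vector,
-- which is its own cover.
cover k zero 1≤k []             _ = 0ℤ ∷ [] , []
cover k zero 1≤k (c ∷ [])       _ = c , covers-self c ∷ []
  where
  covers-self : ∀ c → Covers (suc k) c c
  covers-self (a ∷ []) = here (divides 0ℤ (ℤ.+-inverseʳ a))
cover k zero 1≤k (c ∷ d ∷ L) ≤2 = contradiction (begin
  4                                ≤⟨ ℕ.^-monoʳ-≤ 2 (s≤s 1≤k) ⟩
  2 ^ suc k                        ≤⟨ ℕ.^-monoˡ-≤ (suc k) (s≤s (s≤s (z≤n {length L}))) ⟩
  length (c ∷ d ∷ L) ^ suc k       ≤⟨ ≤2 ⟩
  2                                ∎) (λ { (s≤s (s≤s ())) })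
  where open ℕ.≤-Reasoning
cover k (suc n) 1≤k L ≤2^ = + t ∷ ts , All-unfilter (miss? t) Vec.tail dropped kept L (proj₂ rest)
  where
  miss? : ∀ t (c : Vec ℤ (suc (suc n))) → Dec (¬ + suc k ∣ Vec.head c ℤ.- + t)
  miss? t c = ¬? (+ suc k ∣? (Vec.head c ℤ.- + t))

  cancel : ∀ r b → r ℤ.+ b ℤ.- r ≡ b
  cancel = solve-∀

  -- The filter keeps the vectors that are still uncovered; choosing the residue of its head as `t`
  -- gets a vector dropped.
  residue : ∀ (c : Vec ℤ (suc (suc n))) → ∃ λ t → t < suc k × ¬ ¬ + suc k ∣ Vec.head c ℤ.- + t
  residue (a ∷ _) = a %ℕ suc k , n%ℕd<d a (suc k) , λ ∤ → ∤ (divides (a /ℕ suc k)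
    (trans (cong (ℤ._- + (a %ℕ suc k)) (a≡a%ℕn+[a/ℕn]*n a (suc k))) (cancel (+ (a %ℕ suc k)) ((a /ℕ suc k) ℤ.* + suc k))))

  choice = pigeonhole-filter miss? k residue L
  t      = proj₁ choice
  L′     = List.map Vec.tail (filter (miss? t) L)

  rest : ∃ λ ts → All (Covers (suc k) ts) L′
  rest = cover k n 1≤k L′ (shrink k (suc n)
    (subst (λ l → suc k * l ≤ k * length L) (sym (List.length-map Vec.tail (filter (miss? t) L))) (proj₂ choice)) ≤2^)
  ts = proj₁ rest

  dropped : ∀ c → ¬ ¬ + suc k ∣ Vec.head c ℤ.- + t → Covers (suc k) (+ t ∷ ts) c
  dropped (a ∷ c) ¬miss = here (decidable-stable (+ suc k ∣? (a ℤ.- + t)) ¬miss)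
  kept : ∀ c → Covers (suc k) ts (Vec.tail c) → Covers (suc k) (+ t ∷ ts) c
  kept (a ∷ c) i = there i

-- Zero-sums

Sol : ∀ {R n} → (Fin R → ℕ) → (Fin R → Vec ℤ n) → Vec Bool n → Set
Sol Q g x = ∀ j → + Q j ∣ dotℤ (g j) x

Sol? : ∀ {R n} (Q : Fin R → ℕ) (g : Fin R → Vec ℤ n) x → Dec (Sol Q g x)
Sol? Q g x = Fin.all? λ j → + Q j ∣? dotℤ (g j) x

Sol-zero : ∀ {R n} (Q : Fin R → ℕ) (g : Fin R → Vec ℤ n) → Sol Q g (replicate n false)
Sol-zero Q g j = subst (+ Q j ∣_) (sym (dotℤ-zeroʳ (g j))) (divides 0ℤ refl)

Nonzero : ∀ {n} → Vec Bool n → Set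
Nonzero x = ∃ λ k → lookup x k ≡ true

-- Exhaustive search makes it legitimate to prove the existence of a zero-sum by contradiction.
anyVec? : ∀ n {P : Vec Bool n → Set} → (∀ x → Dec (P x)) → Dec (∃ P)
anyVec? zero    P? = map′ ([] ,_) (λ { ([] , p) → p }) (P? [])
anyVec? (suc n) P? = map′
  [ (λ { (x , p) → false ∷ x , p }) , (λ { (x , p) → true ∷ x , p }) ]′
  (λ { (false ∷ x , p) → inj₁ (x , p) ; (true ∷ x , p) → inj₂ (x , p) })
  (anyVec? n (P? ∘ (false ∷_)) ⊎-dec anyVec? n (P? ∘ (true ∷_)))

module _ {m : ℕ} (1<m : 1 < m) {qs : List ℕ} (unique : Unique qs)
         (qs∥m : ∀ {q} → q ∈ qs → q ∥ m) where

  private instance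
    m-nonZero : NonZero m
    m-nonZero = ℕ.>-nonZero (ℕ.<-trans (s≤s z≤n) 1<m)

  open Kernel (kernel unique (All.tabulate (∥⇒primePower ∘ qs∥m)))

  m-periodic : ∀ {d} → + m ∣ d → ∀ e → κ (e ℤ.+ d) ≡ κ e
  m-periodic m∣d = periodic (All.tabulate λ q∈ → ∣-trans (∣ᵤ⇒∣ (∥⇒∣ (qs∥m q∈))) m∣d)

  -- If every character ψ satisfies ψ(gᵢ) = ω ^ tᵢ for some i, the element ∏ (1 − ω^{-tᵢ} gᵢ) of the group ring
  -- vanishes, but without nontrivial zero-sums its coefficient at the identity is 1.
  nonzero-solution : ∀ {R n} (Q : Fin R → ℕ) → (∀ j → Q j ∈ qs) → (g : Fin R → Vec ℤ (suc n)) →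
                     m ^ (m * R) ≤ 2 ^ suc n → ∃ λ x → Nonzero x × Sol Q g x
  nonzero-solution {R} {n} Q Q∈qs g m^mR≤2^n
    with anyVec? (suc n) (λ x → Fin.any? (λ k → lookup x k Bool.≟ true) ×-dec Sol? Q g x)
  ... | yes found = found
  ... | no  none  = contradiction total≡0 (λ eq → ℕ.<⇒≢ (length-characters-≥ R Q h 1≤Q) (sym (ℤ.+-injective eq)))
    where
    open ≡-Reasoning

    Q∣m : ∀ j → Q j ℕ.∣ m
    Q∣m j = ∥⇒∣ (qs∥m (Q∈qs j))

    1≤Q : ∀ j → 1 ≤ Q j
    1≤Q j = ℕ.n≢0⇒n>0 λ Q≡0 → ℕ.≢-nonZero⁻¹ m (ℕ.0∣⇒≡0 (subst (ℕ._∣ m) Q≡0 (Q∣m j)))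

    -- Multiplication by the cofactor m / Q j embeds the integers modulo `Q j` into those modulo
    -- `m`, so that all characters take exponents modulo `m`. It also makes the values of `h j`
    -- divisible by all other prime powers in `qs`.
    K : Fin R → ℕ
    K j = ℕ.quotient (Q∣m j)

    h : Fin R → Vec ℤ (suc n)
    h j = + K j *ᵛ g j

    L = characters R Q h

    length-bound : length L ^ m ≤ 2 ^ suc n
    length-bound = ℕ.≤-trans (ℕ.^-monoˡ-≤ m (length-characters-≤ m R Q h (λ j → ℕ.∣⇒≤ (Q∣m j))))
      (ℕ.≤-trans (ℕ.≤-reflexive (trans (ℕ.^-*-assoc m R m) (cong (m ^_) (ℕ.*-comm R m)))) m^mR≤2^n)

    covering : ∃ λ t → All (Covers m t) L
    covering = subst (λ m → length L ^ m ≤ 2 ^ suc n → ∃ λ t → All (Covers m t) L) (ℕ.suc-pred m)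
      (cover (ℕ.pred m) n (ℕ.≤-pred (subst (1 <_) (sym (ℕ.suc-pred m)) 1<m)) L) length-bound

    t = proj₁ covering

    term : Vec ℤ (suc n) → Vec Bool (suc n) → ℤ
    term c x = κ (0ℤ ℤ.+ dotℤ (c -ᵛ t) x)

    reorder : ∀ a b → 0ℤ ℤ.+ (a ℤ.- b) ≡ ℤ.- b ℤ.+ a
    reorder = solve-∀

    term-≡ : ∀ x c → term c x ≡ κ (ℤ.- dotℤ t x ℤ.+ dotℤ c x)
    term-≡ x c = cong κ (trans (cong (λ d → 0ℤ ℤ.+ d) (dotℤ--ᵛ c t x)) (reorder (dotℤ c x) (dotℤ t x)))

    averages-to-0 : ∀ x k → lookup x k ≡ true → ΣL (λ c → term c x) L ≡ 0ℤ
    -- A nonzero `x` violates some constraint `j`; the scaled value is then divisible by the other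
    -- prime powers but not by `Q j`, which is the situation of `orthogonal`.
    averages-to-0 x k xₖ with Fin.¬∀⟶∃¬ R _ (λ j → + Q j ∣? dotℤ (g j) x) (λ sol → none (x , (k , xₖ) , sol))
    ... | j , Q∤gx = trans (ΣL-cong (term-≡ x) L) (characters-orthogonal κ x R Q h j
      (orthogonal (Q∈qs j) others (λ d → Q∤gx (∥-cofactor-cancel {k = K j} (qs∥m (Q∈qs j)) m≡KQ (dotℤ (g j) x) (subst (+ Q j ∣_) hx≡ d))))
      (ℤ.- dotℤ t x))
      where
      m≡KQ : m ≡ K j * Q j
      m≡KQ = ℕ._∣_.equality (Q∣m j)
      hx≡ : dotℤ (h j) x ≡ + K j ℤ.* dotℤ (g j) x
      hx≡ = dotℤ-*ᵛ (+ K j) (g j) x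
      others : ∀ {q′} → q′ ∈ qs → q′ ≢ Q j → + q′ ∣ dotℤ (h j) x
      others {q′} q′∈ q′≢ = subst (+ q′ ∣_) (sym hx≡)
        (∣m⇒∣m*n {m = + K j} (dotℤ (g j) x) (∣ᵤ⇒∣ (∥-cofactor-∣ (qs∥m (Q∈qs j)) (qs∥m q′∈) m≡KQ q′≢)))

    -- One double sum is evaluated in both orders. Summing over `c` first leaves only the zero
    -- vector, which contributes `length L`; summing over `x` first gives 0 for every covered `c`.
    total≡0 : + length L ≡ 0ℤ
    total≡0 = begin
      + length L
        ≡⟨ ΣL-one (λ c → trans (cong (λ d → κ (0ℤ ℤ.+ d)) (dotℤ-zeroʳ (c -ᵛ t))) κ-0) L ⟨
      ΣL (λ c → term c (replicate (suc n) false)) L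
        ≡⟨ alternating-single (suc n) averages-to-0 ⟨
      alternating (suc n) (λ x → ΣL (λ c → term c x) L)
        ≡⟨ alternating-ΣL (suc n) term L ⟩
      ΣL (λ c → alternating (suc n) (term c)) L
        ≡⟨ ΣL-zero (All.map (λ {c} cov → alternating-cancel m κ m-periodic (c -ᵛ t) cov 0ℤ) (proj₂ covering)) ⟩
      0ℤ ∎

-- Counting solutions by doubling

AtLeast-1 : ∀ {n} (P : Vec Bool n → Set) x → P x → AtLeast 1 P
AtLeast-1 P x px = (λ _ → x) , (λ { {zero} {zero} _ → refl }) , λ _ → px

AtLeast-map : ∀ {m n c} (P : Vec Bool m → Set) (P′ : Vec Bool n → Set) (f : Vec Bool m → Vec Bool n) →
              Injective _≡_ _≡_ f → (∀ x → P x → P′ (f x)) → AtLeast c P → AtLeast c P′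
AtLeast-map P P′ f f-inj P⇒P′ (e , e-inj , p) = f ∘ e , e-inj ∘ f-inj , λ i → P⇒P′ (e i) (p i)

-- Coordinate `k` separates the two families, so joining their enumerations creates no repetition.
AtLeast-+ : ∀ {n a b} (P : Vec Bool n → Set) (k : Fin n) → AtLeast a (λ x → P x × lookup x k ≡ false) →
            AtLeast b (λ x → P x × lookup x k ≡ true) → AtLeast (a + b) P
AtLeast-+ {n} {a} {b} P k (e , e-inj , p) (f , f-inj , q) = G ∘ splitAt a , inj , λ i → P-G (splitAt a i)
  where
  G = [ e , f ]′
  P-G : ∀ s → P (G s)
  P-G (inj₁ i) = proj₁ (p i)
  P-G (inj₂ j) = proj₁ (q j)
  disjoint : ∀ i j → e i ≢ f j
  disjoint i j eq with trans (sym (proj₂ (p i))) (trans (cong (λ x → lookup x k) eq) (proj₂ (q j)))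
  ... | ()
  G-inj : ∀ s s′ → G s ≡ G s′ → s ≡ s′
  G-inj (inj₁ i) (inj₁ i′) eq = cong inj₁ (e-inj eq)
  G-inj (inj₁ i) (inj₂ j)  eq = contradiction eq (disjoint i j)
  G-inj (inj₂ j) (inj₁ i)  eq = contradiction (sym eq) (disjoint i j)
  G-inj (inj₂ j) (inj₂ j′) eq = cong inj₂ (f-inj eq)
  inj : Injective _≡_ _≡_ (G ∘ splitAt a)
  inj {i} {i′} eq = begin
    i                      ≡⟨ Fin.join-splitAt a b i ⟨
    join a b (splitAt a i)  ≡⟨ cong (join a b) (G-inj (splitAt a i) (splitAt a i′) eq) ⟩
    join a b (splitAt a i′) ≡⟨ Fin.join-splitAt a b i′ ⟩
    i′                     ∎
    where open ≡-Reasoning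

dotℤ-insertAt : ∀ {n} (v : Vec ℤ (suc n)) (x : Vec Bool n) k → dotℤ v (insertAt x k false) ≡ dotℤ (removeAt v k) x
dotℤ-insertAt (a ∷ v)     x           zero    = refl
dotℤ-insertAt (a ∷ b ∷ v) (false ∷ x) (suc k) = dotℤ-insertAt (b ∷ v) x k
dotℤ-insertAt (a ∷ b ∷ v) (true ∷ x)  (suc k) = cong (λ w → a ℤ.+ w) (dotℤ-insertAt (b ∷ v) x k)

insertAt-injective : ∀ {n} (k : Fin (suc n)) (b : Bool) → Injective _≡_ _≡_ (λ x → insertAt x k b)
insertAt-injective k b {x} {y} eq =
  trans (sym (Vec.removeAt-insertAt x k b)) (trans (cong (λ z → removeAt z k) eq) (Vec.removeAt-insertAt y k b))

_⊕_ : ∀ {n} → Vec Bool n → Vec Bool n → Vec Bool n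
_⊕_ = zipWith _xor_

negateOn : ∀ {n} → Vec Bool n → Vec ℤ n → Vec ℤ n
negateOn = zipWith (λ b a → if b then ℤ.- a else a)

-- Flipping a coordinate that is set in `J` removes its entry from the sum, which is the effect of
-- adding the negated entry.
dotℤ-⊕ : ∀ {n} (v : Vec ℤ n) J x → dotℤ v (J ⊕ x) ≡ dotℤ v J ℤ.+ dotℤ (negateOn J v) x
dotℤ-⊕ []      []          []          = refl
dotℤ-⊕ (a ∷ v) (false ∷ J) (false ∷ x) = dotℤ-⊕ v J x
dotℤ-⊕ (a ∷ v) (false ∷ J) (true ∷ x)  = trans (cong (λ w → a ℤ.+ w) (dotℤ-⊕ v J x)) (reorder a (dotℤ v J) _)
  where
  reorder : ∀ a b c → a ℤ.+ (b ℤ.+ c) ≡ b ℤ.+ (a ℤ.+ c)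
  reorder = solve-∀
dotℤ-⊕ (a ∷ v) (true ∷ J)  (false ∷ x) = trans (cong (λ w → a ℤ.+ w) (dotℤ-⊕ v J x)) (sym (ℤ.+-assoc a (dotℤ v J) _))
dotℤ-⊕ (a ∷ v) (true ∷ J)  (true ∷ x)  = trans (dotℤ-⊕ v J x) (cancel a (dotℤ v J) _)
  where
  cancel : ∀ a b c → b ℤ.+ c ≡ (a ℤ.+ b) ℤ.+ (ℤ.- a ℤ.+ c)
  cancel = solve-∀

⊕-involutive : ∀ {n} (J x : Vec Bool n) → J ⊕ (J ⊕ x) ≡ x
⊕-involutive []          []      = refl
⊕-involutive (false ∷ J) (b ∷ x) = cong (b ∷_) (⊕-involutive J x)
⊕-involutive (true ∷ J)  (b ∷ x) = cong₂ _∷_ (Bool.not-involutive b) (⊕-involutive J x)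

⊕-injective : ∀ {n} (J : Vec Bool n) → Injective _≡_ _≡_ (J ⊕_)
⊕-injective J {x} {y} eq = trans (sym (⊕-involutive J x)) (trans (cong (J ⊕_) eq) (⊕-involutive J y))

-- Olson's doubling argument: given a solution J with Jₖ = 1, the solutions with xₖ = 1 are the J ⊕ x, where x
-- solves the system with the columns in J negated and has xₖ = 0.
many-solutions : ∀ {R} (Q : Fin R → ℕ) E → 1 ≤ E →
                 (∀ {n} (g : Fin R → Vec ℤ (suc n)) → E ≤ 2 ^ suc n → ∃ λ x → Nonzero x × Sol Q g x) →
                 ∀ n (g : Fin R → Vec ℤ n) → Σ ℕ λ c → AtLeast c (Sol Q g) × 2 ^ n ≤ c * E
many-solutions Q E 1≤E nonzero zero g =
  1 , AtLeast-1 (Sol Q g) _ (Sol-zero Q g) , ℕ.≤-trans 1≤E (ℕ.≤-reflexive (sym (ℕ.*-identityˡ E)))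
many-solutions Q E 1≤E nonzero (suc n) g with E ℕ.≤? 2 ^ suc n
-- Here `2 ^ suc n < E`, so the zero vector alone meets the bound.
... | no E≰ = 1 , AtLeast-1 (Sol Q g) _ (Sol-zero Q g) , ℕ.≤-trans (ℕ.<⇒≤ (ℕ.≰⇒> E≰)) (ℕ.≤-reflexive (sym (ℕ.*-identityˡ E)))
... | yes E≤ with nonzero g E≤
...   | J , (k , Jₖ) , solJ
  with many-solutions Q E 1≤E nonzero n (λ j → removeAt (g j) k)
     | many-solutions Q E 1≤E nonzero n (λ j → removeAt (negateOn J (g j)) k)
...     | a , atLeast-a , bound-a | b , atLeast-b , bound-b =
  a + b
  , AtLeast-+ (Sol Q g) k
      (AtLeast-map (Sol Q (λ j → removeAt (g j) k)) (λ x → Sol Q g x × lookup x k ≡ false)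
        (λ x → insertAt x k false) (insertAt-injective k false) without-k atLeast-a)
      (AtLeast-map (Sol Q (λ j → removeAt (negateOn J (g j)) k)) (λ x → Sol Q g x × lookup x k ≡ true)
        (λ x → J ⊕ insertAt x k false) (insertAt-injective k false ∘ ⊕-injective J) with-k atLeast-b)
  , (begin
      2 ^ n + (2 ^ n + 0)  ≡⟨ cong (λ w → 2 ^ n + w) (ℕ.+-identityʳ (2 ^ n)) ⟩
      2 ^ n + 2 ^ n        ≤⟨ ℕ.+-mono-≤ bound-a bound-b ⟩
      a * E + b * E        ≡⟨ ℕ.*-distribʳ-+ E a b ⟨
      (a + b) * E          ∎)
  where
  open ℕ.≤-Reasoning
  without-k : ∀ x → Sol Q (λ j → removeAt (g j) k) x →
              Sol Q g (insertAt x k false) × lookup (insertAt x k false) k ≡ false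
  without-k x sol = (λ j → subst (+ Q j ∣_) (sym (dotℤ-insertAt (g j) x k)) (sol j)) , Vec.insertAt-lookup x k false

  with-k : ∀ x → Sol Q (λ j → removeAt (negateOn J (g j)) k) x →
           Sol Q g (J ⊕ insertAt x k false) × lookup (J ⊕ insertAt x k false) k ≡ true
  with-k x sol =
    (λ j → subst (+ Q j ∣_) (sym (dotℤ-⊕ (g j) J (insertAt x k false)))
      (∣m∣n⇒∣m+n (solJ j) (subst (+ Q j ∣_) (sym (dotℤ-insertAt (negateOn J (g j)) x k)) (sol j))))
    , trans (Vec.lookup-zipWith _xor_ k J (insertAt x k false)) (cong₂ _xor_ Jₖ (Vec.insertAt-lookup x k false))

-- The bound in logarithmic form

-- The lower bound 2^n / m^K has no factor log₂ n in its exponent and is the stronger one, since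
-- log₂ n ≥ 1 for `n ≥ 2`. For the rational approximation p₂/q₂ of log₂ n this reads `q₂ ≤ p₂`.
powBound : ∀ K {m n c} → 2 ≤ n → 2 ^ n ≤ c * m ^ K → PowBound K m n c
powBound K {m} {n} {c} 2≤n 2^n≤ p₁ q₁ p₂ q₂ 1≤q₁ 1≤q₂ m^q₁≤ n^q₂≤ = begin
  2 ^ (n * q)                     ≡⟨ ℕ.^-*-assoc 2 n q ⟨
  (2 ^ n) ^ q                     ≤⟨ ℕ.^-monoˡ-≤ q 2^n≤ ⟩
  (c * m ^ K) ^ q                 ≡⟨ ^-distribʳ-* q c (m ^ K) ⟩
  c ^ q * (m ^ K) ^ q             ≤⟨ ℕ.*-monoʳ-≤ (c ^ q) m-bound ⟩
  c ^ q * 2 ^ (K * (p₁ * p₂))     ∎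
  where
  open ℕ.≤-Reasoning
  q = q₁ * q₂

  q₂≤p₂ : q₂ ≤ p₂
  q₂≤p₂ = ℕ.≮⇒≥ λ p₂<q₂ → ℕ.<⇒≱ (ℕ.^-monoʳ-< 2 (s≤s (s≤s z≤n)) p₂<q₂) (ℕ.≤-trans (ℕ.^-monoˡ-≤ q₂ 2≤n) n^q₂≤)

  rearrange : ∀ K a b → K * (a * b) ≡ a * (K * b)
  rearrange = solveℕ-∀

  m-bound : (m ^ K) ^ q ≤ 2 ^ (K * (p₁ * p₂))
  m-bound = begin
    (m ^ K) ^ q              ≡⟨ ℕ.^-*-assoc m K q ⟩
    m ^ (K * (q₁ * q₂))      ≡⟨ cong (m ^_) (rearrange K q₁ q₂) ⟩
    m ^ (q₁ * (K * q₂))      ≡⟨ ℕ.^-*-assoc m q₁ (K * q₂) ⟨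
    (m ^ q₁) ^ (K * q₂)      ≤⟨ ℕ.^-monoˡ-≤ (K * q₂) m^q₁≤ ⟩
    (2 ^ p₁) ^ (K * q₂)      ≡⟨ ℕ.^-*-assoc 2 p₁ (K * q₂) ⟩
    2 ^ (p₁ * (K * q₂))      ≡⟨ cong (2 ^_) (rearrange K p₁ q₂) ⟨
    2 ^ (K * (p₁ * q₂))      ≤⟨ ℕ.^-monoʳ-≤ 2 (ℕ.*-monoʳ-≤ K (ℕ.*-monoʳ-≤ p₁ q₂≤p₂)) ⟩
    2 ^ (K * (p₁ * p₂))      ∎

-- Translation of the given system

toℤᵛ : ∀ {n q} → Vec (Fin q) n → Vec ℤ n
toℤᵛ = Vec.map (+_ ∘ Fin.toℕ)

dotℤ-toℤᵛ : ∀ {n q} (v : Vec (Fin q) n) x → dotℤ (toℤᵛ v) x ≡ + dot v x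
dotℤ-toℤᵛ []      []          = refl
dotℤ-toℤᵛ (a ∷ v) (false ∷ x) = trans (dotℤ-toℤᵛ v x) (cong (λ w → + (w + dot v x)) (sym (ℕ.*-zeroʳ (Fin.toℕ a))))
dotℤ-toℤᵛ (a ∷ v) (true ∷ x)  =
  trans (cong (λ w → + Fin.toℕ a ℤ.+ w) (dotℤ-toℤᵛ v x)) (cong (λ w → + (w + dot v x)) (sym (ℕ.*-identityʳ (Fin.toℕ a))))

-- Flattening the double index (q, i) turns the system into one family indexed by a single `Fin R`,
-- each vector carrying its own modulus.
constraints : ∀ {n} {r : ℕ → ℕ} → ((q : ℕ) → Fin (r q) → Vec (Fin q) n) → List ℕ → List (ℕ × Vec ℤ n)
constraints v []       = []
constraints v (q ∷ qs) = List.tabulate (λ i → q , toℤᵛ (v q i)) ++ constraints v qs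

length-constraints : ∀ {n} {r : ℕ → ℕ} (v : (q : ℕ) → Fin (r q) → Vec (Fin q) n) qs →
                     length (constraints v qs) ≡ sum (List.map r qs)
length-constraints v []       = refl
length-constraints v (q ∷ qs) = trans (List.length-++ (List.tabulate (λ i → q , toℤᵛ (v q i))))
  (cong₂ _+_ (List.length-tabulate _) (length-constraints v qs))

constraints-modulus : ∀ {n} {r : ℕ → ℕ} (v : (q : ℕ) → Fin (r q) → Vec (Fin q) n) qs →
                      All (λ c → proj₁ c ∈ qs) (constraints v qs)
constraints-modulus v []       = []
constraints-modulus v (q ∷ qs) =
  All.++⁺ (All.tabulate⁺ (λ _ → here refl)) (All.map there (constraints-modulus v qs))

∈-constraints : ∀ {n} {r : ℕ → ℕ} (v : (q : ℕ) → Fin (r q) → Vec (Fin q) n) {qs q} → q ∈ qs →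
                ∀ i → (q , toℤᵛ (v q i)) ∈ constraints v qs
∈-constraints v (here refl)              i = ∈-++⁺ˡ (∈-tabulate⁺ i)
∈-constraints v {q ∷ _} (there q∈qs) i = ∈-++⁺ʳ (List.tabulate (λ i → q , toℤᵛ (v q i))) (∈-constraints v q∈qs i)

-- Logarithms are to base 2. At n = 1 the second bound would demand two solutions, since log n = 0,
-- while the equation x = 0 modulo 2 has only one; hence `2 ≤ n` in that part.
theorem3p3 : (m n : ℕ) → 1 < m → 1 ≤ n →
    (qs : List ℕ) → Unique qs → (∀ q → (q ∈ qs → q ∥ m) × (q ∥ m → q ∈ qs)) →
    (r : ℕ → ℕ) → (v : (q : ℕ) → Fin (r q) → Vec (Fin q) n) →
    (m ^ (m * sum (map r qs)) ≤ 2 ^ n → AtLeast 2 (Solution m v)) ×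
    (2 ≤ n → Σ ℕ λ c → AtLeast c (Solution m v) × PowBound (m * sum (map r qs)) m n c)
theorem3p3 m n@(suc n-1) 1<m 1≤n qs unique qs⇔∥ r v = two , many
  where
  E  = m * sum (map r qs)
  cs = constraints v qs
  Q : Fin (length cs) → ℕ
  Q j = proj₁ (List.lookup cs j)
  g : Fin (length cs) → Vec ℤ n
  g j = proj₂ (List.lookup cs j)

  nonzero : ∀ {n′} (g : Fin (length cs) → Vec ℤ (suc n′)) → m ^ (m * sum (map r qs)) ≤ 2 ^ suc n′ →
            ∃ λ x → Nonzero x × Sol Q g x
  nonzero {n′} g bound = nonzero-solution 1<m unique (λ {q} → proj₁ (qs⇔∥ q)) Q
    (λ j → All.lookup (constraints-modulus v qs) (∈-lookup j)) g
    (subst (λ s → m ^ (m * s) ≤ 2 ^ suc n′) (sym (length-constraints v qs)) bound)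

  sol⇒Solution : ∀ x → Sol Q g x → Solution m v x
  sol⇒Solution x sol q q∥m i = ∣⇒∣ᵤ (subst (+ q ∣_) (dotℤ-toℤᵛ (v q i) x)
    (subst (λ c → + proj₁ c ∣ dotℤ (proj₂ c) x) (sym (lookup-index c∈cs)) (sol (index c∈cs))))
    where c∈cs = ∈-constraints v (proj₂ (qs⇔∥ q) q∥m) i

  two : m ^ (m * sum (map r qs)) ≤ 2 ^ n → AtLeast 2 (Solution m v)
  two bound with nonzero g bound
  -- The zero vector and `x` are two solutions told apart by coordinate `k`.
  ... | x , (k , xₖ) , sol = AtLeast-+ (Solution m v) k
    (AtLeast-1 (λ x → Solution m v x × lookup x k ≡ false) (replicate n false)
      (sol⇒Solution _ (Sol-zero Q g) , Vec.lookup-replicate k false))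
    (AtLeast-1 (λ x → Solution m v x × lookup x k ≡ true) x (sol⇒Solution x sol , xₖ))

  many : 2 ≤ n → Σ ℕ λ c → AtLeast c (Solution m v) × PowBound (m * sum (map r qs)) m n c
  many 2≤n with many-solutions Q (m ^ E)
                  (ℕ.m^n>0 m {{ℕ.>-nonZero (ℕ.<-trans (s≤s z≤n) 1<m)}} E) nonzero n g
  ... | c , atLeast , bound = c , AtLeast-map (Sol Q g) (Solution m v) (λ x → x) (λ eq → eq) sol⇒Solution atLeast , powBound E {c = c} 2≤n bound
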